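{- Let $TS=(V,a,Init,Tr)$ be a (symbolic, labeled) transition system and let $\varphi=\psi\rightarrow\forall\pi_1:\xi_1,\ldots,\pi_k:\xi_k\cdot\square\phi$ be a $k$-safety formula. Consider the following system of constrained Horn clauses over the unknown predicates $\{D_M(\mathcal V)\}_{M\in S}$: \begin{align*} &\textstyle\bigwedge_{M\in S}D_M(\mathcal V)\wedge\bigwedge_{i=1}^k Init(V_i)\wedge\psi(\mathcal V)\to\bot\\ &Bad(\mathcal V)\to D_M(\mathcal V)\qquad\text{for every }M\in S\\ &\neg valid_M(\mathcal V)\to D_M(\mathcal V)\qquad\text{for every }M\in S\\ &\textstyle\bigwedge_{M'\in S}D_{M'}(\mathcal V')\wedge\delta_M(\mathcal V,\mathcal V')\to D_M(\mathcal V)\qquad\text{for every }M\in S \end{align*} This system of CHCs is satisfiable if and only if $TS\models\varphi$.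
   Context: Background. Fix a many-sorted first-order theory $\mathcal T$ over signature $\Sigma$ with its intended model; valuations of variables take values in this model, and a set of formulas over $\Sigma$ and unknown (uninterpreted) predicates is satisfiable if the unknown predicates can be interpreted as relations over this model so that all the formulas (with all free variables universally quantified) hold. Transition systems. $TS=(V,a,Init,Tr)$: $V$ is a finite vector of sorted state variables, $a$ a label variable, $Init$ a $\Sigma$-formula over $V$, $Tr$ a $\Sigma$-formula over $V\cup\{a\}\cup V'$ ($V'$ a primed copy of $V$). States are valuations of $V$ (set $\mathcal S$), labels are the values of $a$ (set $\mathcal L$), initial states are those satisfying $Init$, and the transition relation $R\subseteq\mathcal S\times\mathcal L\times\mathcal S$ is the set of valuations satisfying $Tr$. It is assumed total: for every $s\in\mathcal S$ there are $\ell\in\mathcal L$, $s'\in\mathcal S$ with $(s,\ell,s')\in R$. A trace from $s$ is an infinite sequence $s_0,s_1,\ldots$ with $s_0=s$ such that for every $i$ there is $\ell$ with $(s_i,\ell,s_{i+1})\in R$ (it need not start at an initial state). $k$-safety formulas. $k\ge1$; each $\xi_i$ is a $\Sigma$-formula over $V$ (observation points of trace $i$); $\psi,\phi$ are $\Sigma$-formulas over $\mathcal V=V_1\cup\dots\cup V_k$, where $V_j$ is the copy of $V$ indexed by $j$. A composed state $(s_1,\ldots,s_k)\in\mathcal S^k$ is a valuation of $\mathcal V$; it is initial if every $s_i$ is initial. $TS\models\varphi$ iff for every initial composed state $(s_1,\ldots,s_k)\models\psi$ and all traces $t_1,\ldots,t_k$ from $s_1,\ldots,s_k$ respectively, letting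 $t_i'$ be the (finite or infinite) subsequence of states of $t_i$ satisfying $\xi_i$, for every position $j$ that exists in all of $t_1',\ldots,t_k'$ we have $(t_1'[j],\ldots,t_k'[j])\models\phi$. Formulas. $S=\mathcal P(\{1,\ldots,k\})\setminus\{\varnothing\}$ is the set of schedules. $Bad(\mathcal V)=\bigwedge_{i=1}^k\xi_i(V_i)\wedge\neg\phi(\mathcal V)$. $\delta_M(\mathcal V,\mathcal V')=\exists a_1,\ldots,a_k\cdot\bigwedge_{i\in M}Tr(V_i,a_i,V_i')\wedge\bigwedge_{i\notin M}V_i=V_i'$. $valid_M(\mathcal V)=\bigwedge_{i\in M}\neg\xi_i(V_i)$ if $M\ne\{1,\ldots,k\}$, and $valid_M(\mathcal V)=\big(\bigwedge_{i\in M}\neg\xi_i(V_i)\big)\vee\big(\bigwedge_{i\in M}\xi_i(V_i)\big)$ if $M=\{1,\ldots,k\}$. -}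

module Defs where

open import Level using (Level) renaming (suc to lsuc)
open import Data.Bool using (if_then_else_)
import Data.Bool.Properties as Bool
open import Data.Empty.Polymorphic using (⊥)
open import Data.Fin using (Fin; zero; suc)
open import Data.Fin.Subset as Subset using (Subset; Nonempty; ∁; inside; outside)
open import Data.Fin.Subset.Properties using (nonempty?; _∈?_)
open import Data.List using (List; []; _∷_; _++_; map; mapMaybe; filter; foldr; allFin)
open import Data.List.Membership.Propositional using (_∈_; mapWith∈)
open import Data.List.Membership.Propositional.Properties
  using (∈-++⁻; ∈-++⁺ˡ; ∈-++⁺ʳ)
open import Data.List.Relation.Binary.Subset.Propositional using (_⊆_)
open import Data.List.Relation.Binary.Subset.Propositional.Properties
  using (∷⁺ʳ; xs⊆xs++ys; xs⊆ys++xs)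
open import Data.List.Relation.Unary.All as All using (All; []; _∷_)
open import Data.List.Relation.Unary.All.Properties using (++⁺)
open import Data.Maybe as Maybe using (Maybe; just; nothing)
open import Data.Nat using (ℕ; zero; suc)
open import Data.Product using (Σ; ∃; ∃₂; _×_; _,_)
open import Data.Sum using (_⊎_; [_,_]′)
open import Data.Unit.Polymorphic using (⊤)
open import Data.Vec using ([]; _∷_)
open import Data.Vec.Functional using (Vector)
open import Data.Vec.Properties using (≡-dec)
open import Function using (_∘_; id)
open import Relation.Binary.PropositionalEquality using (_≡_)
open import Relation.Nullary using (¬_; does)
open import Relation.Nullary.Decidable using (dec⇒maybe)

record Signature : Set₁ where
  field
    Sort : Set
    Fun  : List Sort → Sort → Set
    Rel  : List Sort → Set

-- Formulas are well-scoped and well-sorted by construction: a context lists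
-- the sorts of the free variables, and a variable of sort s is a proof of s ∈ Γ.
module Syntax (Sig : Signature) where
  open Signature Sig public

  Ctx : Set
  Ctx = List Sort

  infix  8 _≐_
  infix  7 `¬_
  infixr 6 _`∧_
  infixr 5 _`∨_
  infixr 4 _`⇒_

  data Term (Γ : Ctx) : Sort → Set where
    var : ∀ {s} → s ∈ Γ → Term Γ s
    fun : ∀ {ss s} → Fun ss s → All (Term Γ) ss → Term Γ s

  data Formula (Γ : Ctx) : Set where
    rel       : ∀ {ss} → Rel ss → All (Term Γ) ss → Formula Γ
    _≐_       : ∀ {s} → Term Γ s → Term Γ s → Formula Γ
    `⊤ `⊥     : Formula Γ
    `¬_       : Formula Γ → Formula Γ
    _`∧_ _`∨_ _`⇒_ : Formula Γ → Formula Γ → Formula Γ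
    `∀ `∃     : (s : Sort) → Formula (s ∷ Γ) → Formula Γ

  module _ {Γ Δ : Ctx} (ρ : Γ ⊆ Δ) where
    mutual
      renameTerm : ∀ {s} → Term Γ s → Term Δ s
      renameTerm (var x)    = var (ρ x)
      renameTerm (fun f ts) = fun f (renameTerms ts)

      renameTerms : ∀ {ss} → All (Term Γ) ss → All (Term Δ) ss
      renameTerms []       = []
      renameTerms (t ∷ ts) = renameTerm t ∷ renameTerms ts

  rename : ∀ {Γ Δ} → Γ ⊆ Δ → Formula Γ → Formula Δ
  rename ρ (rel r ts) = rel r (renameTerms ρ ts)
  rename ρ (t ≐ u)    = renameTerm ρ t ≐ renameTerm ρ u
  rename ρ `⊤         = `⊤
  rename ρ `⊥         = `⊥
  rename ρ (`¬ A)     = `¬ rename ρ A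
  rename ρ (A `∧ B)   = rename ρ A `∧ rename ρ B
  rename ρ (A `∨ B)   = rename ρ A `∨ rename ρ B
  rename ρ (A `⇒ B)   = rename ρ A `⇒ rename ρ B
  rename ρ (`∀ s A)   = `∀ s (rename (∷⁺ʳ s ρ) A)
  rename ρ (`∃ s A)   = `∃ s (rename (∷⁺ʳ s ρ) A)

  ⋀ : ∀ {Γ} → List (Formula Γ) → Formula Γ
  ⋀ = foldr _`∧_ `⊤

  ⋀[_] : ∀ {Γ k} → Subset k → (Fin k → Formula Γ) → Formula Γ
  ⋀[ M ] A = ⋀ (map A (filter (_∈? M) (allFin _)))

  `∃⋆ : ∀ {Γ} Δ → Formula (Δ ++ Γ) → Formula Γ
  `∃⋆ []      A = A
  `∃⋆ (s ∷ Δ) A = `∃⋆ Δ (`∃ s A)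

  -- The simultaneous equation  ρ(V) = σ(V)  between two copies of V.
  equate : ∀ {V Γ : Ctx} → V ⊆ Γ → V ⊆ Γ → Formula Γ
  equate {V} ρ σ = ⋀ (mapWith∈ V λ x → var (ρ x) ≐ var (σ x))

  copair : ∀ {Γ₁ Γ₂ Δ : Ctx} → Γ₁ ⊆ Δ → Γ₂ ⊆ Δ → Γ₁ ++ Γ₂ ⊆ Δ
  copair {Γ₁} ρ σ x = [ ρ , σ ]′ (∈-++⁻ Γ₁ x)

  -- copies k V is V₁ ∪ … ∪ V_k, and copy i sends a variable of V to its copy in V_i.
  copies : ℕ → Ctx → Ctx
  copies zero    V = []
  copies (suc k) V = V ++ copies k V

  copy : ∀ {k V} → Fin k → V ⊆ copies k V
  copy zero        x = ∈-++⁺ˡ x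
  copy {V = V} (suc i) x = ∈-++⁺ʳ V (copy i x)

  Sentence : Set
  Sentence = Formula []

  record Structure (ℓ : Level) : Set (lsuc ℓ) where
    field
      Carrier : Sort → Set ℓ
      funᴵ    : ∀ {ss s} → Fun ss s → All Carrier ss → Carrier s
      relᴵ    : ∀ {ss} → Rel ss → All Carrier ss → Set ℓ

  module Semantics {ℓ : Level} (𝓜 : Structure ℓ) where
    open Structure 𝓜 public

    Valuation : Ctx → Set ℓ
    Valuation = All Carrier

    module _ {Γ : Ctx} (v : Valuation Γ) where
      mutual
        evalTerm : ∀ {s} → Term Γ s → Carrier s
        evalTerm (var x)    = All.lookup v x
        evalTerm (fun f ts) = funᴵ f (evalTerms ts)

        evalTerms : ∀ {ss} → All (Term Γ) ss → Valuation ss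
        evalTerms []       = []
        evalTerms (t ∷ ts) = evalTerm t ∷ evalTerms ts

    infix 3 _⊩_
    _⊩_ : ∀ {Γ} → Valuation Γ → Formula Γ → Set ℓ
    v ⊩ rel r ts = relᴵ r (evalTerms v ts)
    v ⊩ t ≐ u    = evalTerm v t ≡ evalTerm v u
    v ⊩ `⊤       = ⊤
    v ⊩ `⊥       = ⊥
    v ⊩ `¬ A     = ¬ (v ⊩ A)
    v ⊩ A `∧ B   = (v ⊩ A) × (v ⊩ B)
    v ⊩ A `∨ B   = (v ⊩ A) ⊎ (v ⊩ B)
    v ⊩ A `⇒ B   = (v ⊩ A) → (v ⊩ B)
    v ⊩ `∀ s A   = (c : Carrier s) → c ∷ v ⊩ A
    v ⊩ `∃ s A   = Σ (Carrier s) λ c → c ∷ v ⊩ A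

    merge : ∀ {k V} → Vector (Valuation V) k → Valuation (copies k V)
    merge {zero}  s = []
    merge {suc k} s = ++⁺ (s zero) (merge (s ∘ suc))

  record Theory (ℓ : Level) : Set (lsuc ℓ) where
    field
      Axiom    : Sentence → Set
      intended : Structure ℓ
    open Semantics intended using (_⊩_)
    field
      isModel  : ∀ {A} → Axiom A → [] ⊩ A

  -- Unknown predicates are indexed by U, and ar u lists the argument sorts of u.
  module _ {U : Set} (ar : U → List Sort) where

    Application : Ctx → Set
    Application Γ = Σ U λ u → All (Term Γ) (ar u)

    -- The clause  ⋀ body ∧ constraint → head, where head = nothing stands for ⊥.
    record CHC : Set where
      constructor clause
      field
        vars       : Ctx
        body       : List (Application vars)
        constraint : Formula vars
        head       : Maybe (Application vars)

    module _ {ℓ} (𝓜 : Structure ℓ) where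
      open Semantics 𝓜

      Interpretation : Set (lsuc ℓ)
      Interpretation = (u : U) → Valuation (ar u) → Set ℓ

      module _ (D : Interpretation) where

        HoldsApp : ∀ {Γ} → Valuation Γ → Application Γ → Set ℓ
        HoldsApp v (u , ts) = D u (evalTerms v ts)

        HoldsHead : ∀ {Γ} → Valuation Γ → Maybe (Application Γ) → Set ℓ
        HoldsHead v nothing  = ⊥
        HoldsHead v (just p) = HoldsApp v p

        HoldsCHC : CHC → Set ℓ
        HoldsCHC (clause Γ body C head) =
          (v : Valuation Γ) → All (HoldsApp v) body → v ⊩ C → HoldsHead v head

      Satisfiable : {I : Set} → (I → CHC) → Set (lsuc ℓ)
      Satisfiable system = ∃ λ (D : Interpretation) → ∀ i → HoldsCHC D (system i)

  record TransitionSystem : Set where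
    field
      V    : Ctx
      a    : Sort
      Init : Formula V
      Tr   : Formula (V ++ (a ∷ V))

  record KSafety (V : Ctx) (k : ℕ) : Set where
    field
      ψ : Formula (copies k V)
      ξ : Fin k → Formula V
      φ : Formula (copies k V)

-- Subsequence P t j x: the subsequence of t consisting of the elements
-- satisfying P has a j-th entry (counting from 0), and that entry is x.
data Subsequence {ℓ} {A : Set ℓ} (P : A → Set ℓ) : (ℕ → A) → ℕ → A → Set ℓ where
  skip : ∀ {t j x} → ¬ P (t 0) → Subsequence P (t ∘ suc) j x → Subsequence P t j x
  take : ∀ {t} → P (t 0) → Subsequence P t 0 (t 0)
  drop : ∀ {t j x} → P (t 0) → Subsequence P (t ∘ suc) j x → Subsequence P t (suc j) x

module TransitionSemantics {Sig : Signature} {ℓ : Level}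
  (𝓜 : Syntax.Structure Sig ℓ) (TS : Syntax.TransitionSystem Sig) where
  open Syntax Sig
  open Semantics 𝓜
  open TransitionSystem TS

  State Label : Set ℓ
  State = Valuation V
  Label = Carrier a

  Initial : State → Set ℓ
  Initial s = s ⊩ Init

  R : State → Label → State → Set ℓ
  R s l s′ = ++⁺ s (l ∷ s′) ⊩ Tr

  Total : Set ℓ
  Total = ∀ s → ∃₂ λ l s′ → R s l s′

  IsTraceFrom : State → (ℕ → State) → Set ℓ
  IsTraceFrom s t = t 0 ≡ s × (∀ i → ∃ λ l → R (t i) l (t (suc i)))

  Satisfies : ∀ {k} → KSafety V k → Set ℓ
  Satisfies {k} ϕ =
    (s : Vector State k) → (∀ i → Initial (s i)) → merge s ⊩ ψ →
    (t : Fin k → ℕ → State) → (∀ i → IsTraceFrom (s i) (t i)) →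
    (j : ℕ) (o : Vector State k) →
    (∀ i → Subsequence (_⊩ ξ i) (t i) j (o i)) →
    merge o ⊩ φ
    where open KSafety ϕ

-- Nonemptiness is irrelevant so that a schedule is determined by its set.
record Schedule (k : ℕ) : Set where
  constructor schedule
  field
    set       : Subset k
    .nonempty : Nonempty set

allSubsets : ∀ k → List (Subset k)
allSubsets zero    = [] ∷ []
allSubsets (suc k) = map (outside ∷_) (allSubsets k) ++ map (inside ∷_) (allSubsets k)

allSchedules : ∀ k → List (Schedule k)
allSchedules k =
  mapMaybe (λ M → Maybe.map (λ ne → schedule M ne) (dec⇒maybe (nonempty? M))) (allSubsets k)

module Encoding {Sig : Signature} (TS : Syntax.TransitionSystem Sig)
  {k : ℕ} (ϕ : Syntax.KSafety Sig (Syntax.TransitionSystem.V TS) k) where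
  open Syntax Sig
  open TransitionSystem TS
  open KSafety ϕ

  𝓥 : Ctx
  𝓥 = copies k V

  Init[_] ξ[_] : Fin k → Formula 𝓥
  Init[ i ] = rename (copy i) Init
  ξ[ i ] = rename (copy i) (ξ i)

  Bad : Formula 𝓥
  Bad = ⋀[ Subset.⊤ ] ξ[_] `∧ `¬ φ

  valid : Subset k → Formula 𝓥
  valid M =
    if does (≡-dec Bool._≟_ M Subset.⊤)
    then ⋀[ M ] (λ i → `¬ ξ[ i ]) `∨ ⋀[ M ] ξ[_]
    else ⋀[ M ] (λ i → `¬ ξ[ i ])

  unprimed primed : 𝓥 ⊆ 𝓥 ++ 𝓥
  unprimed = xs⊆xs++ys 𝓥 𝓥
  primed   = xs⊆ys++xs 𝓥 𝓥

  -- 𝓥 ++ 𝓥 is 𝓥 ∪ 𝓥′; the label variables a₁, …, a_k are the k copies of the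
  -- one-variable context a ∷ [].
  δ : Subset k → Formula (𝓥 ++ 𝓥)
  δ M = `∃⋆ labels
    (  ⋀[ M ]   (λ i → rename (copair (cur i) (copair (lab i) (nxt i))) Tr)
    `∧ ⋀[ ∁ M ] (λ i → equate (cur i) (nxt i)))
    where
    labels : Ctx
    labels = copies k (a ∷ [])
    Γ : Ctx
    Γ = labels ++ (𝓥 ++ 𝓥)
    lab : Fin k → (a ∷ []) ⊆ Γ
    lab i x = xs⊆xs++ys labels (𝓥 ++ 𝓥) (copy i x)
    cur nxt : Fin k → V ⊆ Γ
    cur i x = xs⊆ys++xs (𝓥 ++ 𝓥) labels (unprimed (copy i x))
    nxt i x = xs⊆ys++xs (𝓥 ++ 𝓥) labels (primed (copy i x))

  arity : Schedule k → List Sort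
  arity _ = 𝓥

  D : ∀ {Γ} → Schedule k → 𝓥 ⊆ Γ → Application arity Γ
  D M ρ = M , All.tabulate (λ x → var (ρ x))

  data Index : Set where
    query             : Index
    bad invalid step  : Schedule k → Index

  chcs : Index → CHC arity
  chcs query       = clause 𝓥 (map (λ M → D M id) (allSchedules k))
                       (⋀[ Subset.⊤ ] Init[_] `∧ ψ) nothing
  chcs (bad M)     = clause 𝓥 [] Bad (just (D M id))
  chcs (invalid M) = clause 𝓥 [] (`¬ valid (Schedule.set M)) (just (D M id))
  chcs (step M)    = clause (𝓥 ++ 𝓥) (map (λ M′ → D M′ primed) (allSchedules k))
                       (δ (Schedule.set M)) (just (D M unprimed))

{-# OPTIONS --safe #-}
-- Call a composed state losing if some traces from its components all have a j-th
-- observation, for a common j, and these observations violate φ.  Every solution D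
-- contains the losing states in all D_M, by induction on the total number of transitions
-- before the observations: an invalid M is immediate; a valid one either moves only copies
-- that are not at an observation point, which strictly decreases the measure and keeps j,
-- or moves all copies with all at an observation point, where either j = 0 and the state is
-- bad, or the current observations are dropped.  Conversely, if TS satisfies the formula,
-- let D_M hold when the state is bad, M is invalid, or M can move to a losing state.  Then a
-- state in all D_M is losing: look at M = {i | ¬ ξ_i}, or at M = {1,…,k} if that set is empty.
module Submission where

open import Defs
open import Level using (Level)
open import Axiom.ExcludedMiddle using (ExcludedMiddle)
open import Data.Nat using (ℕ; NonZero)
open import Function.Bundles using (_⇔_)

open import Algebra.Definitions.RawMonoid Data.Nat.+-0-rawMonoid using (sum)
import Data.Bool.Properties as Bool
open import Data.Empty using (⊥-elim)
import Data.Empty.Irrelevant as Irrelevant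
import Data.Empty.Polymorphic as Polymorphic
open import Data.Fin using (Fin; zero; suc)
open import Data.Fin.Subset as Subset using (Subset; Nonempty; ∁; inside; outside)
  renaming (_∈_ to _∈ˢ_; _∉_ to _∉ˢ_)
open import Data.Fin.Subset.Properties using (nonempty?; _∈?_; ∈⊤; x∉p⇒x∈∁p; x∈∁p⇒x∉p)
open import Data.List using ([]; _∷_; _++_; map; filter; allFin)
open import Data.List.Membership.Propositional using (_∈_; mapWith∈)
open import Data.List.Membership.Propositional.Properties
  using (∈-++⁻; ∈-++⁺ˡ; ∈-++⁺ʳ; ∈-map⁺; ∈-filter⁺; ∈-filter⁻; ∈-allFin)
open import Data.List.Relation.Binary.Subset.Propositional using (_⊆_)
open import Data.List.Relation.Binary.Subset.Propositional.Properties
  using (∷⁺ʳ; xs⊆xs++ys; xs⊆ys++xs)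
open import Data.List.Relation.Unary.All as All using (All; []; _∷_)
open import Data.List.Relation.Unary.All.Properties using (++⁺; ++⁻; ++↔; map⁺; map⁻)
open import Data.List.Relation.Unary.Any as Any using (here; there)
open import Data.List.Relation.Unary.Any.Properties using (mapMaybe⁺; ++⁺∘++⁻)
open import Data.Maybe as Maybe using (Maybe)
import Data.Maybe.Relation.Unary.Any as MaybeAny
open import Data.Nat using (zero; suc; _≤_; _<_; z≤n)
open import Data.Nat.Induction using (<-wellFounded)
open import Data.Nat.Properties using (≤-refl; <⇒≤; n<1+n; +-mono-≤; +-mono-<-≤; +-mono-≤-<)
open import Data.Product using (∃; ∃₂; _×_; _,_; proj₁; proj₂)
open import Data.Sum using (_⊎_; inj₁; inj₂; [_,_]′)
open import Data.Vec using ([]; _∷_; tabulate)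
open import Data.Vec.Functional using (Vector)
open import Data.Vec.Properties using (≡-dec; lookup∘tabulate; []=⇒lookup; lookup⇒[]=)
open import Function using (_∘_; id; mk⇔; Equivalence; Inverse)
open import Induction.WellFounded using (Acc; acc)
open import Relation.Binary.PropositionalEquality
  using (_≡_; refl; sym; trans; cong; cong₂; subst; subst₂; module ≡-Reasoning)
open import Relation.Nullary using (¬_; Dec; yes; no; does; recompute)
open import Relation.Nullary.Decidable using (dec⇒maybe; dec-true; decidable-stable)

open Equivalence using (to; from)

-- Monotonicity of finite sums and completeness of the list of schedules.

sum-mono-≤ : ∀ {n} {f g : Vector ℕ n} → (∀ i → f i ≤ g i) → sum f ≤ sum g
sum-mono-≤ {zero}  f≤g = z≤n
sum-mono-≤ {suc n} f≤g = +-mono-≤ (f≤g zero) (sum-mono-≤ (f≤g ∘ suc))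

sum-mono-< : ∀ {n} {f g : Vector ℕ n} → (∀ i → f i ≤ g i) → (i : Fin n) → f i < g i → sum f < sum g
sum-mono-< f≤g zero    f<g = +-mono-<-≤ f<g (sum-mono-≤ (f≤g ∘ suc))
sum-mono-< f≤g (suc i) f<g = +-mono-≤-< (f≤g zero) (sum-mono-< (f≤g ∘ suc) i f<g)

nonempty-⊤ : ∀ {k} .{{_ : NonZero k}} → Nonempty {k} Subset.⊤
nonempty-⊤ {suc k} = zero , ∈⊤

∈-allSubsets : ∀ {k} (M : Subset k) → M ∈ allSubsets k
∈-allSubsets []                = here refl
∈-allSubsets (outside ∷ M)     = ∈-++⁺ˡ (∈-map⁺ (outside ∷_) (∈-allSubsets M))
∈-allSubsets {suc k} (inside ∷ M) =
  ∈-++⁺ʳ (map (outside ∷_) (allSubsets k)) (∈-map⁺ (inside ∷_) (∈-allSubsets M))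

-- The decision procedure may find a proof of nonemptiness other than `ne`; irrelevance of the field
-- makes the two schedules definitionally equal.
∈-allSchedules : ∀ {k} (M : Schedule k) → M ∈ allSchedules k
∈-allSchedules {k} (schedule M ne) =
  mapMaybe⁺ toSchedule (allSubsets k) (Any.map schedule≡ (∈-map⁺ toSchedule (∈-allSubsets M)))
  where
  toSchedule : Subset k → Maybe (Schedule k)
  toSchedule M = Maybe.map (λ ne → schedule M ne) (dec⇒maybe (nonempty? M))
  schedule≡ : ∀ {m} → toSchedule M ≡ m → MaybeAny.Any (schedule M ne ≡_) m
  schedule≡ refl with nonempty? M
  ... | yes _ = MaybeAny.just refl
  ... | no ¬ne = Irrelevant.⊥-elim (¬ne ne)

-- Families indexed by the elements of a list.

module _ {a ℓ} {A : Set a} {P : A → Set ℓ} where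

  All-ext : ∀ {xs} {p q : All P xs} → (∀ {x} (i : x ∈ xs) → All.lookup p i ≡ All.lookup q i) → p ≡ q
  All-ext {p = []}    {[]}    eq = refl
  All-ext {p = _ ∷ _} {_ ∷ _} eq = cong₂ _∷_ (eq (here refl)) (All-ext (eq ∘ there))

  lookup-tabulate : ∀ {xs} (f : ∀ {x} → x ∈ xs → P x) {x} (i : x ∈ xs) →
                    All.lookup {xs = xs} (All.tabulate f) i ≡ f i
  lookup-tabulate f (here refl) = refl
  lookup-tabulate f (there i)   = lookup-tabulate (f ∘ there) i

  lookup-++⁺ˡ : ∀ {xs ys} (p : All P xs) (q : All P ys) {x} (i : x ∈ xs) →
                All.lookup (++⁺ p q) (∈-++⁺ˡ i) ≡ All.lookup p i
  lookup-++⁺ˡ (_ ∷ _) q (here refl) = refl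
  lookup-++⁺ˡ (_ ∷ p) q (there i)   = lookup-++⁺ˡ p q i

  lookup-++⁺ʳ : ∀ {xs ys} (p : All P xs) (q : All P ys) {x} (i : x ∈ ys) →
                All.lookup (++⁺ p q) (∈-++⁺ʳ xs i) ≡ All.lookup q i
  lookup-++⁺ʳ []      q i = refl
  lookup-++⁺ʳ (_ ∷ p) q i = lookup-++⁺ʳ p q i

module _ {a b ℓ} {A : Set a} {B : Set b} {P : B → Set ℓ} where

  All-mapWith∈⁺ : ∀ xs {f : ∀ {x} → x ∈ xs → B} → (∀ {x} (i : x ∈ xs) → P (f i)) → All P (mapWith∈ {A = A} xs f)
  All-mapWith∈⁺ []       p = []
  All-mapWith∈⁺ (x ∷ xs) p = p (here refl) ∷ All-mapWith∈⁺ xs (p ∘ there)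

  All-mapWith∈⁻ : ∀ xs {f : ∀ {x} → x ∈ xs → B} → All P (mapWith∈ {A = A} xs f) → ∀ {x} (i : x ∈ xs) → P (f i)
  All-mapWith∈⁻ (x ∷ xs) (p ∷ _)  (here refl) = p
  All-mapWith∈⁻ (x ∷ xs) (_ ∷ ps) (there i)   = All-mapWith∈⁻ xs ps i

-- Semantics of renaming, of derived connectives and of composed states.

module SemanticProperties (Sig : Signature) {ℓ : Level} (𝓜 : Syntax.Structure Sig ℓ) where
  open Syntax Sig
  open Semantics 𝓜

  pull : ∀ {Γ Δ} → Γ ⊆ Δ → Valuation Δ → Valuation Γ
  pull ρ v = All.tabulate (λ x → All.lookup v (ρ x))

  -- A record rather than a function type, so that unification can recover ρ, v and w.
  record Restricts {Γ Δ} (ρ : Γ ⊆ Δ) (v : Valuation Δ) (w : Valuation Γ) : Set ℓ where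
    constructor restricts
    field at : ∀ {s} (x : s ∈ Γ) → All.lookup v (ρ x) ≡ All.lookup w x
  open Restricts

  pull-restricts : ∀ {Γ Δ} (ρ : Γ ⊆ Δ) (v : Valuation Δ) → Restricts ρ v (pull ρ v)
  pull-restricts ρ v = restricts λ x → sym (lookup-tabulate (λ y → All.lookup v (ρ y)) x)

  restricts⇒pull≡ : ∀ {Γ Δ} (ρ : Γ ⊆ Δ) {v : Valuation Δ} {w : Valuation Γ} → Restricts ρ v w → pull ρ v ≡ w
  restricts⇒pull≡ ρ {v} r = All-ext (λ x → trans (sym (at (pull-restricts ρ v) x)) (at r x))

  evalTerms-vars : ∀ {Γ Δ} (ρ : Γ ⊆ Δ) (v : Valuation Δ) →
                   evalTerms v (All.tabulate (λ x → var (ρ x))) ≡ pull ρ v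
  evalTerms-vars {[]}    ρ v = refl
  evalTerms-vars {s ∷ Γ} ρ v = cong (All.lookup v (ρ (here refl)) ∷_) (evalTerms-vars (ρ ∘ there) v)

  module _ {Γ Δ} {ρ : Γ ⊆ Δ} {v : Valuation Δ} {w : Valuation Γ} (r : Restricts ρ v w) where
    mutual
      evalTerm-rename : ∀ {s} (t : Term Γ s) → evalTerm v (renameTerm ρ t) ≡ evalTerm w t
      evalTerm-rename (var x)    = at r x
      evalTerm-rename (fun f ts) = cong (funᴵ f) (evalTerms-rename ts)

      evalTerms-rename : ∀ {ss} (ts : All (Term Γ) ss) → evalTerms v (renameTerms ρ ts) ≡ evalTerms w ts
      evalTerms-rename []       = refl
      evalTerms-rename (t ∷ ts) = cong₂ _∷_ (evalTerm-rename t) (evalTerms-rename ts)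

  restricts-∷ : ∀ {Γ Δ} {ρ : Γ ⊆ Δ} {v w s} (c : Carrier s) → Restricts ρ v w →
                Restricts (∷⁺ʳ s ρ) (c ∷ v) (c ∷ w)
  restricts-∷ c r = restricts λ { (here refl) → refl ; (there x) → at r x }

  -- Induction on the formula. Both directions are proved together because negation and implication
  -- swap them; `restricts-∷` carries the hypothesis under a binder.
  ⊩-rename : ∀ {Γ Δ} {ρ : Γ ⊆ Δ} {v w} → Restricts ρ v w → (A : Formula Γ) → (v ⊩ rename ρ A) ⇔ (w ⊩ A)
  ⊩-rename r (rel R ts) =
    mk⇔ (subst (relᴵ R) (evalTerms-rename r ts)) (subst (relᴵ R) (sym (evalTerms-rename r ts)))
  ⊩-rename r (t ≐ u) =
    mk⇔ (subst₂ _≡_ (evalTerm-rename r t) (evalTerm-rename r u))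
        (subst₂ _≡_ (sym (evalTerm-rename r t)) (sym (evalTerm-rename r u)))
  ⊩-rename r `⊤ = mk⇔ id id
  ⊩-rename r `⊥ = mk⇔ id id
  ⊩-rename r (`¬ A) = mk⇔ (_∘ from (⊩-rename r A)) (_∘ to (⊩-rename r A))
  ⊩-rename r (A `∧ B) =
    mk⇔ (λ (p , q) → to (⊩-rename r A) p , to (⊩-rename r B) q)
        (λ (p , q) → from (⊩-rename r A) p , from (⊩-rename r B) q)
  ⊩-rename r (A `∨ B) =
    mk⇔ [ inj₁ ∘ to (⊩-rename r A) , inj₂ ∘ to (⊩-rename r B) ]′
        [ inj₁ ∘ from (⊩-rename r A) , inj₂ ∘ from (⊩-rename r B) ]′
  ⊩-rename r (A `⇒ B) =
    mk⇔ (λ f → to (⊩-rename r B) ∘ f ∘ from (⊩-rename r A))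
        (λ f → from (⊩-rename r B) ∘ f ∘ to (⊩-rename r A))
  ⊩-rename r (`∀ s A) =
    mk⇔ (λ f c → to (⊩-rename (restricts-∷ c r) A) (f c))
        (λ f c → from (⊩-rename (restricts-∷ c r) A) (f c))
  ⊩-rename r (`∃ s A) =
    mk⇔ (λ (c , p) → c , to (⊩-rename (restricts-∷ c r) A) p)
        (λ (c , p) → c , from (⊩-rename (restricts-∷ c r) A) p)

  ⊩-⋀ : ∀ {Γ} {v : Valuation Γ} As → (v ⊩ ⋀ As) ⇔ All (v ⊩_) As
  ⊩-⋀ []       = mk⇔ (λ _ → []) _
  ⊩-⋀ (A ∷ As) =
    mk⇔ (λ (p , ps) → p ∷ to (⊩-⋀ As) ps) (λ { (p ∷ ps) → p , from (⊩-⋀ As) ps })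

  ⊩-⋀[] : ∀ {Γ k} (v : Valuation Γ) (M : Subset k) (A : Fin k → Formula Γ) →
          (v ⊩ ⋀[ M ] A) ⇔ (∀ i → i ∈ˢ M → v ⊩ A i)
  ⊩-⋀[] {k = k} v M A =
    mk⇔ (λ p i i∈M → All.lookup (map⁻ (to (⊩-⋀ As) p)) (∈-filter⁺ (_∈? M) (∈-allFin i) i∈M))
        (λ f → from (⊩-⋀ As) (map⁺ (All.tabulate λ {i} i∈ →
                 f i (proj₂ (∈-filter⁻ (_∈? M) {xs = allFin k} i∈)))))
    where As = map A (filter (_∈? M) (allFin k))

  ⊩-∃⋆ : ∀ {Γ} Δ {v : Valuation Γ} {A} → (v ⊩ `∃⋆ Δ A) ⇔ (∃ λ (w : Valuation Δ) → ++⁺ w v ⊩ A)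
  ⊩-∃⋆ []      = mk⇔ ([] ,_) (λ { ([] , p) → p })
  ⊩-∃⋆ (s ∷ Δ) {A = A} =
    mk⇔ (λ p → let w , c , q = to (⊩-∃⋆ Δ {A = `∃ s A}) p in c ∷ w , q)
        (λ { (c ∷ w , p) → from (⊩-∃⋆ Δ {A = `∃ s A}) (w , c , p) })

  ⊩-equate : ∀ {Γ Δ} {ρ σ : Γ ⊆ Δ} {v : Valuation Δ} {p q} → Restricts ρ v p → Restricts σ v q →
             (v ⊩ equate ρ σ) ⇔ (p ≡ q)
  ⊩-equate {Γ} {ρ = ρ} {σ} {v} r r′ =
    mk⇔ (λ e → All-ext λ x → trans (sym (at r x)) (trans (All-mapWith∈⁻ Γ (to (⊩-⋀ eqs) e) x) (at r′ x)))
        (λ { refl → from (⊩-⋀ eqs) (All-mapWith∈⁺ Γ λ x → trans (at r x) (sym (at r′ x))) })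
    where eqs = mapWith∈ Γ λ x → var (ρ x) ≐ var (σ x)

  -- `copair` computes only once the variable is assigned to a side, so `by-cases` argues about an
  -- arbitrary such assignment, and `++⁺∘++⁻` returns to `x`.
  restricts-copair : ∀ {Γ₁ Γ₂ Δ} {ρ : Γ₁ ⊆ Δ} {σ : Γ₂ ⊆ Δ} {v p q} →
                     Restricts ρ v p → Restricts σ v q → Restricts (copair ρ σ) v (++⁺ p q)
  restricts-copair {Γ₁} {Γ₂} {ρ = ρ} {σ} {v} {p} {q} r r′ = restricts λ x → begin
    All.lookup v (copair ρ σ x)                          ≡⟨ by-cases (∈-++⁻ Γ₁ x) ⟩
    All.lookup (++⁺ p q) ([ ∈-++⁺ˡ , ∈-++⁺ʳ Γ₁ ]′ (∈-++⁻ Γ₁ x)) ≡⟨ cong (All.lookup (++⁺ p q)) (++⁺∘++⁻ Γ₁ x) ⟩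
    All.lookup (++⁺ p q) x                               ∎
    where
    open ≡-Reasoning
    by-cases : ∀ {s} (y : s ∈ Γ₁ ⊎ s ∈ Γ₂) →
               All.lookup v ([ ρ , σ ]′ y) ≡ All.lookup (++⁺ p q) ([ ∈-++⁺ˡ , ∈-++⁺ʳ Γ₁ ]′ y)
    by-cases (inj₁ x) = trans (at r x) (sym (lookup-++⁺ˡ p q x))
    by-cases (inj₂ x) = trans (at r′ x) (sym (lookup-++⁺ʳ p q x))

  restricts-++⁺ˡ : ∀ {Γ Δ} (v : Valuation Γ) (w : Valuation Δ) → Restricts (xs⊆xs++ys Γ Δ) (++⁺ v w) v
  restricts-++⁺ˡ v w = restricts (lookup-++⁺ˡ v w)

  restricts-++⁺ʳ : ∀ {Γ Δ} (v : Valuation Γ) (w : Valuation Δ) → Restricts (xs⊆ys++xs Δ Γ) (++⁺ v w) w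
  restricts-++⁺ʳ v w = restricts (lookup-++⁺ʳ v w)

  restricts-trans : ∀ {Γ Δ Θ} {ρ : Γ ⊆ Δ} {σ : Δ ⊆ Θ} {u v w} →
                    Restricts σ u v → Restricts ρ v w → Restricts (λ x → σ (ρ x)) u w
  restricts-trans {ρ = ρ} r r′ = restricts λ x → trans (at r (ρ x)) (at r′ x)

  restricts-copy : ∀ {k V} (s : Vector (Valuation V) k) i → Restricts (copy i) (merge s) (s i)
  restricts-copy s zero    = restricts-++⁺ˡ (s zero) (merge (s ∘ suc))
  restricts-copy s (suc i) = restricts-trans (restricts-++⁺ʳ (s zero) (merge (s ∘ suc))) (restricts-copy (s ∘ suc) i)

  merge-cong : ∀ {k V} {s t : Vector (Valuation V) k} → (∀ i → s i ≡ t i) → merge s ≡ merge t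
  merge-cong {zero}  s≗t = refl
  merge-cong {suc k} s≗t = cong₂ ++⁺ (s≗t zero) (merge-cong (s≗t ∘ suc))

  merge-surjective : ∀ k {V} (v : Valuation (copies k V)) → ∃ λ (s : Vector (Valuation V) k) → merge s ≡ v
  merge-surjective zero    []      = (λ ()) , refl
  merge-surjective (suc k) {V} v =
    let p , q = ++⁻ V v
        s , eq = merge-surjective k q
    in  (λ { zero → p ; (suc i) → s i })
      , trans (cong (++⁺ p) eq) (Inverse.strictlyInverseˡ (++↔ {xs = V}) v)

  module Components (k : ℕ) (V : Ctx) where

    infix 9 _⟨_⟩
    _⟨_⟩ : Valuation (copies k V) → Fin k → Valuation V
    v ⟨ i ⟩ = pull (copy i) v

    restricts-⟨⟩ : ∀ v i → Restricts (copy i) v (v ⟨ i ⟩)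
    restricts-⟨⟩ v i = pull-restricts (copy i) v

    merge-⟨⟩ : ∀ s i → merge s ⟨ i ⟩ ≡ s i
    merge-⟨⟩ s i = restricts⇒pull≡ (copy i) (restricts-copy s i)

    -- Surjectivity of `merge` lets `v` be taken as `merge s`, where `merge-⟨⟩` settles each
    -- component.
    ⟨⟩-merge : ∀ v → merge (v ⟨_⟩) ≡ v
    ⟨⟩-merge v with s , refl ← merge-surjective k v = merge-cong (merge-⟨⟩ s)

-- Finite paths to an observation versus infinite traces.

module Reachability {Sig : Signature} {ℓ : Level}
  (𝓜 : Syntax.Structure Sig ℓ) (TS : Syntax.TransitionSystem Sig) where
  open TransitionSemantics 𝓜 TS

  module _ (P : State → Set ℓ) where

    -- Reach n s j x: after n transitions from s, some trace is at its j-th P-state (counting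
    -- from 0), and that state is x.
    data Reach : ℕ → State → ℕ → State → Set ℓ where
      now  : ∀ {s} → P s → Reach 0 s 0 s
      skip : ∀ {n s l s′ j x} → ¬ P s → R s l s′ → Reach n s′ j x → Reach (suc n) s j x
      drop : ∀ {n s l s′ j x} → P s → R s l s′ → Reach n s′ j x → Reach (suc n) s (suc j) x

    Progress : ℕ → State → ℕ → State → Set ℓ
    Progress n s j x = ∃₂ λ m s′ → m < n × ∃ (λ l → R s l s′) × Reach m s′ j x

  module _ {P : State → Set ℓ} where

    now⁻ : ∀ {n s x} → P s → Reach P n s 0 x → x ≡ s
    now⁻ p (now _)       = refl
    now⁻ p (skip ¬p _ _) = ⊥-elim (¬p p)

    skip⁻ : ∀ {n s j x} → ¬ P s → Reach P n s j x → Progress P n s j x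
    skip⁻ ¬p (now p)      = ⊥-elim (¬p p)
    skip⁻ ¬p (skip _ r d) = _ , _ , n<1+n _ , (_ , r) , d
    skip⁻ ¬p (drop p _ _) = ⊥-elim (¬p p)

    drop⁻ : ∀ {n s j x} → P s → Reach P n s (suc j) x → Progress P n s j x
    drop⁻ p (skip ¬p _ _) = ⊥-elim (¬p p)
    drop⁻ p (drop _ r d)  = _ , _ , n<1+n _ , (_ , r) , d

    -- A `j`-th observation is witnessed by a finite prefix of the trace, whose number of
    -- transitions becomes `n`.
    subsequence⇒reach : ∀ {t j x} → (∀ i → ∃ λ l → R (t i) l (t (suc i))) →
                        Subsequence P t j x → ∃ λ n → Reach P n (t 0) j x
    subsequence⇒reach tr (skip ¬p d) =
      let n , r = subsequence⇒reach (tr ∘ suc) d in suc n , skip ¬p (proj₂ (tr 0)) r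
    subsequence⇒reach tr (take p)    = 0 , now p
    subsequence⇒reach tr (drop p d)  =
      let n , r = subsequence⇒reach (tr ∘ suc) d in suc n , drop p (proj₂ (tr 0)) r

    module _ (total : Total) where

      run : State → ℕ → State
      run s zero    = s
      run s (suc n) = proj₁ (proj₂ (total (run s n)))

      run-step : ∀ s i → ∃ λ l → R (run s i) l (run s (suc i))
      run-step s i = proj₁ (total (run s i)) , proj₂ (proj₂ (total (run s i)))

      prepend : State → (ℕ → State) → ℕ → State
      prepend s t zero    = s
      prepend s t (suc i) = t i

      prepend-trace : ∀ {s l s′ t} → R s l s′ → IsTraceFrom s′ t → IsTraceFrom s (prepend s t)
      prepend-trace r (refl , tr) = refl , λ { zero → _ , r ; (suc i) → tr i }

      -- Totality extends the finite path to a trace: from the observed state on, `run` follows the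
      -- successors that `total` supplies.
      reach⇒subsequence : ∀ {n s j x} → Reach P n s j x →
                          ∃ λ t → IsTraceFrom s t × Subsequence P t j x
      reach⇒subsequence {s = s} (now p) = run s , (refl , run-step s) , take p
      reach⇒subsequence {s = s} (skip ¬p r d) =
        let t , tr , sub = reach⇒subsequence d in prepend s t , prepend-trace r tr , skip ¬p sub
      reach⇒subsequence {s = s} (drop p r d) =
        let t , tr , sub = reach⇒subsequence d in prepend s t , prepend-trace r tr , drop p sub

-- Semantic form of the Horn clauses.

module Clauses (Sig : Signature) {ℓ : Level} (𝓜 : Syntax.Structure Sig ℓ)
  (TS : Syntax.TransitionSystem Sig) (total : TransitionSemantics.Total 𝓜 TS)
  {k : ℕ} (ϕ : Syntax.KSafety Sig (Syntax.TransitionSystem.V TS) k) where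
  open Syntax Sig
  open TransitionSystem TS
  open KSafety ϕ
  open Semantics 𝓜
  open SemanticProperties Sig 𝓜
  open TransitionSemantics 𝓜 TS
  open Encoding TS ϕ
  open Components k V

  -- One disjunction covers both branches of the conditional in `valid`: the equation makes the
  -- second alternative empty for every proper subset.
  Valid : Subset k → Valuation 𝓥 → Set ℓ
  Valid M v = (∀ i → i ∈ˢ M → ¬ (v ⟨ i ⟩ ⊩ ξ i)) ⊎ (M ≡ Subset.⊤ × ∀ i → v ⟨ i ⟩ ⊩ ξ i)

  Move : Subset k → Valuation 𝓥 → Valuation 𝓥 → Set ℓ
  Move M v v′ = (∀ i → i ∈ˢ M → ∃ λ l → R (v ⟨ i ⟩) l (v′ ⟨ i ⟩)) × (∀ i → i ∉ˢ M → v ⟨ i ⟩ ≡ v′ ⟨ i ⟩)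

  ⊩-copy : ∀ v i A → (v ⊩ rename (copy i) A) ⇔ (v ⟨ i ⟩ ⊩ A)
  ⊩-copy v i = ⊩-rename (restricts-⟨⟩ v i)

  ⊩-everywhere : ∀ v (A : Fin k → Formula V) →
                 (v ⊩ ⋀[ Subset.⊤ ] (λ i → rename (copy i) (A i))) ⇔ (∀ i → v ⟨ i ⟩ ⊩ A i)
  ⊩-everywhere v A =
    mk⇔ (λ p i → to (⊩-copy v i (A i)) (to all p i ∈⊤))
        (λ f → from all λ i _ → from (⊩-copy v i (A i)) (f i))
    where all = ⊩-⋀[] v Subset.⊤ λ i → rename (copy i) (A i)

  ⊩-nowhere : ∀ v M → (v ⊩ ⋀[ M ] (λ i → `¬ ξ[ i ])) ⇔ (∀ i → i ∈ˢ M → ¬ (v ⟨ i ⟩ ⊩ ξ i))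
  ⊩-nowhere v M =
    mk⇔ (λ p i i∈M → to all p i i∈M ∘ from (⊩-copy v i (ξ i)))
        (λ f → from all λ i i∈M → f i i∈M ∘ to (⊩-copy v i (ξ i)))
    where all = ⊩-⋀[] v M λ i → `¬ ξ[ i ]

  ⊩-valid : ∀ v M → (v ⊩ valid M) ⇔ Valid M v
  ⊩-valid v M with ≡-dec Bool._≟_ M Subset.⊤
  ... | yes refl =
    mk⇔ [ inj₁ ∘ to (⊩-nowhere v M) , (λ p → inj₂ (refl , to (⊩-everywhere v ξ) p)) ]′
        [ inj₁ ∘ from (⊩-nowhere v M) , (λ (_ , p) → inj₂ (from (⊩-everywhere v ξ) p)) ]′
  ... | no M≢⊤ =
    mk⇔ (inj₁ ∘ to (⊩-nowhere v M))
        [ from (⊩-nowhere v M) , (λ (M≡⊤ , _) → ⊥-elim (M≢⊤ M≡⊤)) ]′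

  -- This context and `lab`, `cur`, `nxt` below repeat the definitions local to `δ`, with which they
  -- agree by computation.
  labels : Ctx
  labels = copies k (a ∷ [])

  open Components k (a ∷ []) using () renaming (_⟨_⟩ to _⟨_⟩ᵃ; restricts-⟨⟩ to restricts-⟨⟩ᵃ)

  lab : Fin k → (a ∷ []) ⊆ labels ++ (𝓥 ++ 𝓥)
  lab i x = xs⊆xs++ys labels (𝓥 ++ 𝓥) (copy i x)

  cur nxt : Fin k → V ⊆ labels ++ (𝓥 ++ 𝓥)
  cur i x = xs⊆ys++xs (𝓥 ++ 𝓥) labels (unprimed (copy i x))
  nxt i x = xs⊆ys++xs (𝓥 ++ 𝓥) labels (primed (copy i x))

  module _ (v v′ : Valuation 𝓥) (w : Valuation labels) where
    private
      u : Valuation (labels ++ (𝓥 ++ 𝓥))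
      u = ++⁺ w (++⁺ v v′)

      lab-restricts : ∀ i → Restricts (lab i) u (w ⟨ i ⟩ᵃ)
      lab-restricts i = restricts-trans (restricts-++⁺ˡ w _) (restricts-⟨⟩ᵃ w i)

      cur-restricts : ∀ i → Restricts (cur i) u (v ⟨ i ⟩)
      cur-restricts i = restricts-trans (restricts-++⁺ʳ w _)
        (restricts-trans (restricts-++⁺ˡ v v′) (restricts-⟨⟩ v i))

      nxt-restricts : ∀ i → Restricts (nxt i) u (v′ ⟨ i ⟩)
      nxt-restricts i = restricts-trans (restricts-++⁺ʳ w _)
        (restricts-trans (restricts-++⁺ʳ v v′) (restricts-⟨⟩ v′ i))

    ⊩-Tr : ∀ i → (u ⊩ rename (copair (cur i) (copair (lab i) (nxt i))) Tr)
               ⇔ (++⁺ (v ⟨ i ⟩) (++⁺ (w ⟨ i ⟩ᵃ) (v′ ⟨ i ⟩)) ⊩ Tr)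
    ⊩-Tr i = ⊩-rename
      (restricts-copair (cur-restricts i) (restricts-copair (lab-restricts i) (nxt-restricts i))) Tr

    ⊩-idle : ∀ i → (u ⊩ equate (cur i) (nxt i)) ⇔ (v ⟨ i ⟩ ≡ v′ ⟨ i ⟩)
    ⊩-idle i = ⊩-equate (cur-restricts i) (nxt-restricts i)

    ⊩-Trs : ∀ M → (u ⊩ ⋀[ M ] λ i → rename (copair (cur i) (copair (lab i) (nxt i))) Tr)
                ⇔ (∀ i → i ∈ˢ M → R (v ⟨ i ⟩) (All.lookup w (copy i (here refl))) (v′ ⟨ i ⟩))
    ⊩-Trs M = mk⇔ (λ p i i∈M → to (⊩-Tr i) (to all p i i∈M)) (λ f → from all λ i i∈M → from (⊩-Tr i) (f i i∈M))
      where all = ⊩-⋀[] u M _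

    ⊩-idles : ∀ M → (u ⊩ ⋀[ ∁ M ] λ i → equate (cur i) (nxt i)) ⇔ (∀ i → i ∉ˢ M → v ⟨ i ⟩ ≡ v′ ⟨ i ⟩)
    ⊩-idles M = mk⇔ (λ p i i∉M → to (⊩-idle i) (to all p i (x∉p⇒x∈∁p i∉M)))
                    (λ f → from all λ i i∈∁M → from (⊩-idle i) (f i (x∈∁p⇒x∉p i∈∁M)))
      where all = ⊩-⋀[] u (∁ M) _

  ⊩-δ : ∀ v v′ M → (++⁺ v v′ ⊩ δ M) ⇔ Move M v v′
  ⊩-δ v v′ M = mk⇔ δ⇒move move⇒δ
    where
    δ⇒move : ++⁺ v v′ ⊩ δ M → Move M v v′
    δ⇒move p =
      let w , moves , idles = to (⊩-∃⋆ labels) p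
      in  (λ i i∈M → _ , to (⊩-Trs v v′ w M) moves i i∈M) , to (⊩-idles v v′ w M) idles

    move⇒δ : Move M v v′ → ++⁺ v v′ ⊩ δ M
    move⇒δ (moves , idles) =
      from (⊩-∃⋆ labels) (w , from (⊩-Trs v v′ w M) moves′ , from (⊩-idles v v′ w M) idles)
      where
      -- δ also quantifies over the labels of the copies that stay put; totality supplies them.
      label : ∀ i → ∃ λ l → i ∈ˢ M → R (v ⟨ i ⟩) l (v′ ⟨ i ⟩)
      label i with i ∈? M
      ... | yes i∈M = let l , r = moves i i∈M in l , λ _ → r
      ... | no  i∉M = proj₁ (total (v ⟨ i ⟩)) , ⊥-elim ∘ i∉M
      w : Valuation labels
      w = merge λ i → proj₁ (label i) ∷ []
      moves′ : ∀ i → i ∈ˢ M → R (v ⟨ i ⟩) (All.lookup w (copy i (here refl))) (v′ ⟨ i ⟩)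
      moves′ i i∈M = subst (λ z → R (v ⟨ i ⟩) z (v′ ⟨ i ⟩))
        (sym (Restricts.at (restricts-copy (λ i → proj₁ (label i) ∷ []) i) (here refl))) (proj₂ (label i) i∈M)

  -- The four kinds of clauses freed of syntax; a valuation of unprimed and primed variables becomes
  -- two composed states.
  record Solution (I : Schedule k → Valuation 𝓥 → Set ℓ) : Set ℓ where
    field
      safe      : ∀ {v} → (∀ M → I M v) → (∀ i → Initial (v ⟨ i ⟩)) → ¬ (v ⊩ ψ)
      ⊇-bad     : ∀ {v} M → (∀ i → v ⟨ i ⟩ ⊩ ξ i) → ¬ (v ⊩ φ) → I M v
      ⊇-invalid : ∀ {v} M → ¬ Valid (Schedule.set M) v → I M v
      ⊇-step    : ∀ {v v′} M → Move (Schedule.set M) v v′ → (∀ M′ → I M′ v′) → I M v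

  module _ (I : Interpretation arity 𝓜) where

    module _ {Γ} {ρ : 𝓥 ⊆ Γ} {v : Valuation Γ} {w : Valuation 𝓥} (r : Restricts ρ v w) where
      private
        eq : evalTerms v (All.tabulate (λ x → var (ρ x))) ≡ w
        eq = trans (evalTerms-vars ρ v) (restricts⇒pull≡ ρ r)

      holds-D : ∀ M → HoldsApp arity 𝓜 I v (D M ρ) ⇔ I M w
      holds-D M = mk⇔ (subst (I M) eq) (subst (I M) (sym eq))

      -- Completeness of `allSchedules` turns the conjunction in a clause body into a quantifier
      -- over schedules.
      holds-all-D : All (HoldsApp arity 𝓜 I v) (map (λ M → D M ρ) (allSchedules k)) ⇔ (∀ M → I M w)
      holds-all-D =
        mk⇔ (λ ps M → to (holds-D M) (All.lookup (map⁻ ps) (∈-allSchedules M)))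
            (λ f → map⁺ (All.tabulate λ {M} _ → from (holds-D M) (f M)))

    private
      id-restricts : ∀ v → Restricts {Γ = 𝓥} id v v
      id-restricts v = restricts λ _ → refl

    solution : (∀ i → HoldsCHC arity 𝓜 I (chcs i)) ⇔ Solution I
    solution = mk⇔ ⇒ ⇐
      where
      ⇒ : (∀ i → HoldsCHC arity 𝓜 I (chcs i)) → Solution I
      ⇒ holds = record
        { safe = λ {v} all init ψv →
            Polymorphic.⊥-elim (holds query v (from (holds-all-D (id-restricts v)) all)
              (from (⊩-everywhere v (λ _ → Init)) init , ψv))
        ; ⊇-bad = λ {v} M ξv ¬φv →
            to (holds-D (id-restricts v) M) (holds (bad M) v [] (from (⊩-everywhere v ξ) ξv , ¬φv))
        ; ⊇-invalid = λ {v} M ¬valid →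
            to (holds-D (id-restricts v) M) (holds (invalid M) v [] (¬valid ∘ to (⊩-valid v (Schedule.set M))))
        ; ⊇-step = λ {v} {v′} M move all →
            to (holds-D (restricts-++⁺ˡ v v′) M)
              (holds (step M) (++⁺ v v′) (from (holds-all-D (restricts-++⁺ʳ v v′)) all)
                (from (⊩-δ v v′ (Schedule.set M)) move))
        }
      ⇐ : Solution I → ∀ i → HoldsCHC arity 𝓜 I (chcs i)
      ⇐ sol query v all (init , ψv) =
        ⊥-elim (safe (to (holds-all-D (id-restricts v)) all) (to (⊩-everywhere v (λ _ → Init)) init) ψv)
        where open Solution sol
      ⇐ sol (bad M) v [] (ξv , ¬φv) = from (holds-D (id-restricts v) M) (⊇-bad M (to (⊩-everywhere v ξ) ξv) ¬φv)
        where open Solution sol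
      ⇐ sol (invalid M) v [] ¬valid =
        from (holds-D (id-restricts v) M) (⊇-invalid M (¬valid ∘ from (⊩-valid v (Schedule.set M))))
        where open Solution sol
      -- The clause speaks of one valuation of `𝓥 ++ 𝓥`; splitting it exposes the current state `p`
      -- and the next state `q`.
      ⇐ sol (step M) v all d with ++⁻ 𝓥 v | Inverse.strictlyInverseˡ (++↔ {xs = 𝓥}) v
      ... | p , q | refl =
        from (holds-D (restricts-++⁺ˡ p q) M)
          (⊇-step M (to (⊩-δ p q (Schedule.set M)) d) (to (holds-all-D (restricts-++⁺ʳ p q)) all))
        where open Solution sol

-- Losing states and the two implications.

module Correctness {ℓ : Level} (em : ExcludedMiddle ℓ)
  (Sig : Signature) (𝓜 : Syntax.Structure Sig ℓ)
  (TS : Syntax.TransitionSystem Sig) (total : TransitionSemantics.Total 𝓜 TS)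
  {k : ℕ} (ϕ : Syntax.KSafety Sig (Syntax.TransitionSystem.V TS) k) where
  open Syntax Sig
  open TransitionSystem TS
  open KSafety ϕ
  open Semantics 𝓜
  open SemanticProperties Sig 𝓜
  open TransitionSemantics 𝓜 TS
  open Reachability 𝓜 TS
  open Encoding TS ϕ using (𝓥)
  open Components k V
  open Clauses Sig 𝓜 TS total ϕ

  -- The index `j` is shared by all copies, while each copy has its own number `n i` of transitions,
  -- since schedules may move copies at different speeds.
  Reaches : (Fin k → ℕ) → Valuation 𝓥 → ℕ → Vector State k → Set ℓ
  Reaches n v j o = ∀ i → Reach (_⊩ ξ i) (n i) (v ⟨ i ⟩) j (o i)

  Losing : Valuation 𝓥 → Set ℓ
  Losing v = ∃ λ j → ∃₂ λ o n → ¬ (merge o ⊩ φ) × Reaches n v j o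

  module _ {I} (sol : Solution I) where
    open Solution sol

    -- Well-founded induction on `sum n`, for all schedules at once, because `⊇-step` asks for the
    -- successor to lie in `I M′` for every `M′`.
    losing⇒doomed : ∀ v {j o} n → Acc _<_ (sum n) → ¬ (merge o ⊩ φ) → Reaches n v j o → ∀ M → I M v
    losing⇒doomed v {j} {o} n (acc rec) ¬φo r M@(schedule S S≠∅) = decide j r em
      where
      -- Shared by the two moving cases: `j′` is `j` when the moved copies are unobserved, and its
      -- predecessor when all copies consume an observation.
      advance : ∀ j′ → (∀ i → i ∈ˢ S → Progress (_⊩ ξ i) (n i) (v ⟨ i ⟩) j′ (o i)) →
                (∀ i → i ∉ˢ S → Reach (_⊩ ξ i) (n i) (v ⟨ i ⟩) j′ (o i)) → I M v
      advance j′ progress idle = ⊇-step {v′ = merge s′} M (moves , idles)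
        (losing⇒doomed (merge s′) m (rec (sum-mono-< m≤n (proj₁ i∈S) (m<n _ (proj₂ i∈S)))) ¬φo r′)
        where
        -- Nonemptiness is stored irrelevantly; deciding it recovers an actual member, whose strict
        -- decrease makes the sum drop.
        i∈S : Nonempty S
        i∈S = recompute (nonempty? S) S≠∅
        -- Counts, successors and their properties come from a single case split, so that they fit
        -- together.
        next : ∀ i → ∃₂ λ m s′ → m ≤ n i × (i ∈ˢ S → m < n i × ∃ λ l → R (v ⟨ i ⟩) l s′)
                                × (i ∉ˢ S → v ⟨ i ⟩ ≡ s′) × Reach (_⊩ ξ i) m s′ j′ (o i)
        next i with i ∈? S
        ... | yes i∈S = let m , s′ , m<n , tr , r = progress i i∈S in
          m , s′ , <⇒≤ m<n , (λ _ → m<n , tr) , (λ i∉S → ⊥-elim (i∉S i∈S)) , r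
        ... | no  i∉S = n i , v ⟨ i ⟩ , ≤-refl , ⊥-elim ∘ i∉S , (λ _ → refl) , idle i i∉S
        m : Fin k → ℕ
        m i = proj₁ (next i)
        s′ : Vector State k
        s′ i = proj₁ (proj₂ (next i))
        m≤n : ∀ i → m i ≤ n i
        m≤n i = let _ , _ , le , _ = next i in le
        m<n : ∀ i → i ∈ˢ S → m i < n i
        m<n i i∈S = let _ , _ , _ , lt , _ = next i in proj₁ (lt i∈S)
        moves : ∀ i → i ∈ˢ S → ∃ λ l → R (v ⟨ i ⟩) l (merge s′ ⟨ i ⟩)
        moves i i∈S rewrite merge-⟨⟩ s′ i = let _ , _ , _ , tr , _ = next i in proj₂ (tr i∈S)
        idles : ∀ i → i ∉ˢ S → v ⟨ i ⟩ ≡ merge s′ ⟨ i ⟩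
        idles i i∉S rewrite merge-⟨⟩ s′ i = let _ , _ , _ , _ , eq , _ = next i in eq i∉S
        r′ : Reaches m (merge s′) j′ o
        r′ i rewrite merge-⟨⟩ s′ i = let _ , _ , _ , _ , _ , d = next i in d
      decide : ∀ j → Reaches n v j o → Dec (Valid S v) → I M v
      decide j       r (no ¬valid)           = ⊇-invalid M ¬valid
      decide j       r (yes (inj₁ ¬ξ))       = advance j (λ i i∈S → skip⁻ (¬ξ i i∈S) (r i)) (λ i _ → r i)
      -- With index 0 and every copy observed, the observations are the current states, so `merge o`
      -- is `v` and `v` is bad.
      decide zero    r (yes (inj₂ (_ , ξv))) = ⊇-bad M ξv
        (¬φo ∘ subst (_⊩ φ) (sym (trans (merge-cong λ i → now⁻ (ξv i) (r i)) (⟨⟩-merge v))))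
      -- Here `S` is the full set: every copy drops its current observation and none stays idle.
      decide (suc j) r (yes (inj₂ (refl , ξv))) =
        advance j (λ i _ → drop⁻ (ξv i) (r i)) (λ i i∉S → ⊥-elim (i∉S ∈⊤))

    -- A violation of `φ` would make the initial composed state losing, hence a member of every
    -- `I M`, against `safe`.
    solution⇒satisfies : Satisfies ϕ
    solution⇒satisfies s init ψs t tr j o sub with em {merge o ⊩ φ}
    ... | yes φo = φo
    ... | no ¬φo = ⊥-elim (safe {merge s} doomed (λ i → subst Initial (sym (merge-⟨⟩ s i)) (init i)) ψs)
      where
      reach : ∀ i → ∃ λ n → Reach (_⊩ ξ i) n (merge s ⟨ i ⟩) j (o i)
      reach i = subst (λ z → ∃ λ n → Reach (_⊩ ξ i) n z j (o i)) (trans (proj₁ (tr i)) (sym (merge-⟨⟩ s i)))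
        (subsequence⇒reach (proj₂ (tr i)) (sub i))
      doomed = losing⇒doomed (merge s) (proj₁ ∘ reach) (<-wellFounded _) ¬φo (proj₂ ∘ reach)

  -- The alternatives mirror the clauses with head `D_M`. Putting `Losing v′` for membership of `v′`
  -- in all predicates keeps the definition from being recursive.
  Doomed : Schedule k → Valuation 𝓥 → Set ℓ
  Doomed M v = ((∀ i → v ⟨ i ⟩ ⊩ ξ i) × ¬ (v ⊩ φ))
             ⊎ ¬ Valid (Schedule.set M) v
             ⊎ ∃ λ v′ → Move (Schedule.set M) v v′ × Losing v′

  -- Subsets are Boolean vectors, so excluded middle is what turns a predicate into a schedule.
  comprehension : (Q : Fin k → Set ℓ) → ∃ λ (N : Subset k) → ∀ i → (i ∈ˢ N) ⇔ Q i
  comprehension Q = N , λ i → mk⇔ (sound i) (complete i)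
    where
    N = tabulate λ i → does (em {Q i})
    sound : ∀ i → i ∈ˢ N → Q i
    sound i i∈N with em {Q i} | trans (sym (lookup∘tabulate (λ i → does (em {Q i})) i)) ([]=⇒lookup i∈N)
    ... | yes q | _ = q
    complete : ∀ i → Q i → i ∈ˢ N
    complete i q = lookup⇒[]= i N (trans (lookup∘tabulate _ i) (dec-true em q))

  -- The schedule inspected is valid by its choice, which excludes the second alternative of
  -- `Doomed`. If `N` is nonempty, one of its copies is unobserved and the state is not bad.
  -- Otherwise the full set is used, a schedule because `k` is nonzero.
  doomed⇒losing : .{{NonZero k}} → ∀ v → (∀ M → Doomed M v) → Losing v
  doomed⇒losing v doomed with comprehension (λ i → ¬ (v ⟨ i ⟩ ⊩ ξ i))
  ... | N , N⇔¬ξ with nonempty? N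
  ...   | yes N≠∅ = lose (doomed (schedule N N≠∅))
    where
    lose : Doomed (schedule N N≠∅) v → Losing v
    lose (inj₁ (ξv , _))      = let i , i∈N = N≠∅ in ⊥-elim (to (N⇔¬ξ i) i∈N (ξv i))
    lose (inj₂ (inj₁ ¬valid)) = ⊥-elim (¬valid (inj₁ λ i → to (N⇔¬ξ i)))
    lose (inj₂ (inj₂ (v′ , (moves , idles) , j , o , n , ¬φo , r))) =
      j , o , proj₁ ∘ reach , ¬φo , proj₂ ∘ reach
      where
      -- The copies in `N` gain one unobserved transition and the others keep their path, so the
      -- index `j` is unchanged.
      reach : ∀ i → ∃ λ n → Reach (_⊩ ξ i) n (v ⟨ i ⟩) j (o i)
      reach i with i ∈? N
      ... | yes i∈N = _ , skip (to (N⇔¬ξ i) i∈N) (proj₂ (moves i i∈N)) (r i)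
      ... | no  i∉N = _ , subst (λ s → Reach _ _ s _ _) (sym (idles i i∉N)) (r i)
  ...   | no  N≡∅ = lose (doomed (schedule Subset.⊤ nonempty-⊤))
    where
    -- Emptiness of `N` yields only the double negation of `ξ i`, which excluded middle removes.
    ξv : ∀ i → v ⟨ i ⟩ ⊩ ξ i
    ξv i = decidable-stable em λ ¬ξ → N≡∅ (i , from (N⇔¬ξ i) ¬ξ)
    lose : Doomed (schedule Subset.⊤ nonempty-⊤) v → Losing v
    lose (inj₁ (_ , ¬φv)) =
      0 , v ⟨_⟩ , (λ _ → 0) , (¬φv ∘ subst (_⊩ φ) (⟨⟩-merge v)) , λ i → now (ξv i)
    lose (inj₂ (inj₁ ¬valid)) = ⊥-elim (¬valid (inj₂ (refl , ξv)))
    -- The current states become observation 0 of all copies, shifting the violating index from `j`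
    -- to `suc j`.
    lose (inj₂ (inj₂ (v′ , (moves , _) , j , o , n , ¬φo , r))) =
      suc j , o , suc ∘ n , ¬φo , λ i → drop (ξv i) (proj₂ (moves i ∈⊤)) (r i)

  -- Both `⊇-step` and `safe` rest on `doomed⇒losing`; for `safe`, the finite paths of a losing
  -- initial state extend to traces that violate `φ`.
  satisfies⇒solution : .{{NonZero k}} → Satisfies ϕ → Solution Doomed
  satisfies⇒solution sat = record
    { safe      = λ {v} → safe v
    ; ⊇-bad     = λ _ ξv ¬φv → inj₁ (ξv , ¬φv)
    ; ⊇-invalid = λ _ ¬valid → inj₂ (inj₁ ¬valid)
    ; ⊇-step    = λ {_} {v′} _ move doomed → inj₂ (inj₂ (v′ , move , doomed⇒losing v′ doomed))
    }
    where
    safe : ∀ v → (∀ M → Doomed M v) → (∀ i → Initial (v ⟨ i ⟩)) → ¬ (v ⊩ ψ)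
    safe v doomed init ψv =
      let j , o , n , ¬φo , r = doomed⇒losing v doomed
          trace i = reach⇒subsequence total (r i)
      in ¬φo (sat (v ⟨_⟩) init (subst (_⊩ ψ) (sym (⟨⟩-merge v)) ψv)
               (λ i → proj₁ (trace i)) (λ i → proj₁ (proj₂ (trace i))) j o (λ i → proj₂ (proj₂ (trace i))))

corollary5p7 : ∀ {ℓ : Level} → ExcludedMiddle ℓ →
    (Sig : Signature) (𝓣 : Syntax.Theory Sig ℓ) →
    (TS : Syntax.TransitionSystem Sig) →
    TransitionSemantics.Total (Syntax.Theory.intended 𝓣) TS →
    (k : ℕ) .{{_ : NonZero k}} →
    (ϕ : Syntax.KSafety Sig (Syntax.TransitionSystem.V TS) k) →
    Syntax.Satisfiable Sig (Encoding.arity TS ϕ) (Syntax.Theory.intended 𝓣) (Encoding.chcs TS ϕ)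
    ⇔ TransitionSemantics.Satisfies (Syntax.Theory.intended 𝓣) TS ϕ
corollary5p7 em Sig 𝓣 TS total k ϕ =
  mk⇔ (λ (I , holds) → solution⇒satisfies (to (solution I) holds))
      (λ sat → Doomed , from (solution Doomed) (satisfies⇒solution sat))
  where
  open Clauses Sig (Syntax.Theory.intended 𝓣) TS total ϕ
  open Correctness em Sig (Syntax.Theory.intended 𝓣) TS total ϕ
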